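{- Let $\mathcal{V}=(V,(f^\sharp)_{f\in E},(\mathfrak{g}^{\mathcal{V}})_{\mathfrak{g}\in F})$ be a locally Laver-like partially endomorphic algebra, where each $f\in E\cup F$ has an arity $n_f$, each $f^\sharp$ ($f\in E$) is an $(n_f+1)$-ary operation, and each $\mathfrak{g}^{\mathcal{V}}$ ($\mathfrak{g}\in F$) is an $n_{\mathfrak{g}}$-ary operation. Let $X$ be a set and let $v_x\in V$ for each $x\in X$. Let $f_x$ be a function symbol of arity $n_f$ for $f\in E,x\in X$, and let $\mathcal{G}=\{f_x\mid f\in E,x\in X\}\cup F$. Define $L\subseteq\mathbf{T}_{\mathcal{G}}(X)$ and $\phi:L\to V$ by recursion on terms: (i) $x\in L$ and $\phi(x)=v_x$ for $x\in X$; (ii) $\mathfrak{g}(\ell_1,\dots,\ell_n)\in L$ iff $\ell_1,\dots,\ell_n\in L$, and then $\phi(\mathfrak{g}(\ell_1,\dots,\ell_n))=\mathfrak{g}^{\mathcal{V}}(\phi(\ell_1),\dots,\phi(\ell_n))$, for $\mathfrak{g}\in F$; (iii) $f_x(\ell_1,\dots,\ell_n)\in L$ iff $\ell_1,\dots,\ell_n\in L$ and $(f,\phi(\ell_1),\dots,\phi(\ell_n))\notin\mathrm{Li}(\Gamma(V,(f^\sharp)_{f\in E}))$, and then $\phi(f_x(\ell_1,\dots,\ell_n))=f^\sharp(\phi(\ell_1),\dots,\phi(\ell_n),v_x)$, for $f\in E$, $x\in X$. Then (1) the set $L$ is locally operable; (2) the mapping $\phi$ is a homomorphism from $(L,(f^\sharp)_{f\in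 E},(\mathfrak{g})_{\mathfrak{g}\in F})$ to $\mathcal{V}$; (3) the algebra $(L,(f^\sharp)_{f\in E},(\mathfrak{g})_{\mathfrak{g}\in F})$ is a partially endomorphic Laver table; (4) if $\mathcal{V}$ is a Laver-like partially endomorphic algebra, then $L$ is operable.
   Context: Partially endomorphic algebra of type $(E,F)$: an algebra in which, for each $f\in E$ (with $(n_f+1)$-ary operation $f^\sharp$) and all $a_1,\dots,a_{n_f}$, the map $x\mapsto f^\sharp(a_1,\dots,a_{n_f},x)$ is an endomorphism of the whole algebra (with respect to all operations from $E$ and $F$). Hull: $\Gamma(V,(f^\sharp)_{f\in E})$ has underlying set $\bigcup_{f\in E}\{f\}\times V^{n_f}$ and operation $(s,x_1,\dots,x_{n_s})*(t,y_1,\dots,y_{n_t})=(t,s^\sharp(x_1,\dots,x_{n_s},y_1),\dots,s^\sharp(x_1,\dots,x_{n_s},y_{n_t}))$; it is an LD-system ($x*(y*z)=(x*y)*(x*z)$). For an LD-system $Z$, $\mathrm{Li}(Z)$ is the set of $z$ with $z*w=w$ for all $w$. $Z$ is Laver-like if $\mathrm{Li}(Z)$ is a left-ideal ($w\in\mathrm{Li}(Z)\Rightarrow z*w\in\mathrm{Li}(Z)$) and for every sequence $(z_n)_{n\in\omega}$ in $Z$ there is $n$ with $(\cdots(z_0*z_1)*\cdots)*z_n\in\mathrm{Li}(Z)$. A partially endomorphic algebra is Laver-like if its hull $\Gamma(V,(f^\sharp)_{f\in E})$ is Laver-like; it is locally Laver-like if for all finite $U\subseteq E$, $W\subseteq F$,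 every finitely generated subalgebra of the reduct $(V,(f^\sharp)_{f\in U},(\mathfrak{g}^{\mathcal{V}})_{\mathfrak{g}\in W})$ is Laver-like. $\mathbf{T}_{\mathcal{G}}(X)$ is the set of terms over $\mathcal{G}$ with variables in $X$. Operability of a set $L\subseteq\mathbf{T}_{\mathcal{G}}(X)$ that is closed under subterms, contains $X$, is closed under the symbols of $F$, and satisfies $f_x(\ell_1,\dots,\ell_n)\in L$ iff $f_y(\ell_1,\dots,\ell_n)\in L$: let $\Omega=\{(f,\ell_1,\dots,\ell_{n_f})\mid f\in E,\ \ell_i\in L\}$. By transfinite recursion some elements of $\Omega$ get an ordinal rank, and $f^\sharp(\ell_1,\dots,\ell_{n_f},\ell)\in L$ is defined for all $\ell\in L$ once $(f,\ell_1,\dots,\ell_{n_f})$ has a rank. If $f_x(\ell_1,\dots,\ell_{n_f})\notin L$, then the rank is $0$ and $f^\sharp(\ell_1,\dots,\ell_{n_f},\ell)=\ell$. For $\alpha>0$ and $w=(g,\ell_1,\dots,\ell_n)\in\Omega$ with no rank $<\alpha$, define a partial function $Q:L\to L$ by recursion: $Q(x)=g_x(\ell_1,\dots,\ell_n)$ for $x\in X$; $Q(\mathfrak{f}(u_1,\dots,u_m))=\mathfrak{f}(Q(u_1),\dots,Q(u_m))$ for $\mathfrak{f}\in F$ if all $Q(u_i)$ are defined; $Q(f_x(u_1,\dots,u_m))=f^\sharp(Q(u_1),\dots,Q(u_m),g_x(\ell_1,\dots,\ell_n))$ for $f\in E$ if all $Q(u_i)$ are defined and $(f,Q(u_1),\dots,Q(u_m))$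 has rank $<\alpha$; otherwise undefined. If $Q$ is total, $w$ has rank $\alpha$ and $g^\sharp(\ell_1,\dots,\ell_n,\ell)=Q(\ell)$. $L$ is operable if every element of $\Omega$ has a rank. For finite $Y\subseteq X$, $U\subseteq E$, $W\subseteq F$ let $L_{Y,U,W}$ be the set of terms in $L$ using only variables from $Y$ and symbols $f_y$ ($f\in U,y\in Y$) and $\mathfrak{g}\in W$. $L$ is locally operable if all $L_{Y,U,W}$ are operable (with $Y,U,W$ in place of $X,E,F$); then the operations $g^\sharp$ on these sets fit together to operations $g^\sharp:L^{n_g+1}\to L$ ($g\in E$). The algebra $(L,(g^\sharp)_{g\in E},(\mathfrak{g})_{\mathfrak{g}\in F})$, with $\mathfrak{g}\in F$ acting as term formation, is then called a partially pre-endomorphic Laver table, and a partially endomorphic Laver table if in addition it is a partially endomorphic algebra.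
   Formalization: Part (2) is stated under the extra assumption that if E is nonempty then some f in E has n_f ≥ 1; when all n_f = 0, Li is the whole hull, every f♯ on L is the identity, and φ need not be a homomorphism. -}

module Defs where

open import Level using (Level) renaming (suc to lsuc)
open import Algebra.Core using (Op₂)
open import Data.Irrelevant using (Irrelevant; [_])
import Data.Irrelevant as Irrelevant
open import Data.List.Base using (List)
import Data.List.Membership.Propositional as List
open import Data.Nat.Base using (ℕ; zero; suc; _<_)
open import Data.Product.Base using (Σ; Σ-syntax; ∃; ∃-syntax; _×_; _,_; proj₁; proj₂)
open import Data.Refinement.Base using (Refinement; Refinement-syntax; _,_; value; proof)
open import Data.Sum.Base using (_⊎_)
open import Data.Unit.Polymorphic.Base using (⊤)
open import Data.Vec.Base using (Vec; []; _∷_; map)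
open import Data.Vec.Relation.Binary.Pointwise.Inductive using (Pointwise)
open import Data.Vec.Relation.Unary.All using (All; []; _∷_)
open import Relation.Binary.PropositionalEquality.Core using (_≡_)
open import Relation.Nullary.Negation.Core using (¬_)
open import Relation.Unary using (Pred; _∈_; _∉_; _∩_)

private
  variable
    a ℓ : Level

-- Subsets used as carriers are the types [ x ∈ A ∣ P x ] of Data.Refinement:
-- the membership proof is irrelevant, so two elements are equal as soon as
-- their values are.

values : {A : Set a} {P : Pred A ℓ} {n : ℕ} → Vec [ x ∈ A ∣ P x ] n → Vec A n
values = map value

proofs : {A : Set a} {P : Pred A ℓ} {n : ℕ} (xs : Vec [ x ∈ A ∣ P x ] n) →
         Irrelevant (All P (values xs))
proofs []             = [ [] ]
proofs ((_ , p) ∷ xs) = Irrelevant.zipWith _∷_ p (proofs xs)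

------------------------------------------------------------------------
-- Algebras of type (E , F)

record Type (ℓ : Level) : Set (lsuc ℓ) where
  field
    E F : Set ℓ
    nE  : E → ℕ
    nF  : F → ℕ

-- The (n_f + 1)-ary operation f ♯ takes its last argument separately.

record Algebra (τ : Type ℓ) : Set (lsuc ℓ) where
  open Type τ
  field
    Carrier : Set ℓ
    _♯      : (f : E) → Vec Carrier (nE f) → Carrier → Carrier
    op      : (g : F) → Vec Carrier (nF g) → Carrier

module _ {τ : Type ℓ} where
  open Type τ

  record IsHomomorphism (A B : Algebra τ)
         (h : Algebra.Carrier A → Algebra.Carrier B) : Set ℓ where
    private
      module A = Algebra A
      module B = Algebra B
    field
      ♯-homo  : ∀ f as a → h ((f A.♯) as a) ≡ (f B.♯) (map h as) (h a)
      op-homo : ∀ g as → h (A.op g as) ≡ B.op g (map h as)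

  IsPartiallyEndomorphic : Algebra τ → Set ℓ
  IsPartiallyEndomorphic A = ∀ f as → IsHomomorphism A A ((f ♯) as)
    where open Algebra A

------------------------------------------------------------------------
-- Laver-like LD-systems and algebras

module _ {Z : Set ℓ} (_*_ : Op₂ Z) where

  Li : Pred Z ℓ
  Li z = ∀ w → (z * w) ≡ w

  leftProduct : (ℕ → Z) → ℕ → Z
  leftProduct z zero    = z zero
  leftProduct z (suc n) = leftProduct z n * z (suc n)

  record LaverLike : Set ℓ where
    field
      leftIdeal  : ∀ z w → w ∈ Li → (z * w) ∈ Li
      nilpotence : ∀ (z : ℕ → Z) → ∃[ n ] leftProduct z n ∈ Li

module _ {τ : Type ℓ} (A : Algebra τ) where
  open Type τ
  open Algebra A

  Hull : Set ℓ
  Hull = Σ[ f ∈ E ] Vec Carrier (nE f)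

  hull* : Op₂ Hull
  hull* (s , xs) (t , ys) = t , map ((s ♯) xs) ys

  IsLaverLike : Set ℓ
  IsLaverLike = LaverLike hull*

  data Generated (G : List Carrier) : Pred Carrier ℓ where
    gen : ∀ {a} → a List.∈ G → Generated G a
    ♯-c : ∀ f {as a} → All (Generated G) as → Generated G a → Generated G ((f ♯) as a)
    op-c : ∀ g {as} → All (Generated G) as → Generated G (op g as)

  generatedSubalgebra : List Carrier → Algebra τ
  generatedSubalgebra G = record
    { Carrier = [ a ∈ Carrier ∣ Generated G a ]
    ; _♯      = λ f as a → (f ♯) (values as) (value a)
                         , Irrelevant.zipWith (♯-c f) (proofs as) (proof a)
    ; op      = λ g as → op g (values as) , Irrelevant.map (op-c g) (proofs as)
    }

module _ {τ : Type ℓ} where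
  open Type τ

  -- Finite subsets are listed; repetitions in a list are harmless.

  reductType : List E → List F → Type ℓ
  reductType U W = record
    { E  = [ f ∈ E ∣ f List.∈ U ]
    ; F  = [ g ∈ F ∣ g List.∈ W ]
    ; nE = λ f → nE (value f)
    ; nF = λ g → nF (value g)
    }

  reduct : Algebra τ → (U : List E) (W : List F) → Algebra (reductType U W)
  reduct A U W = record
    { Carrier = Carrier
    ; _♯      = λ f → value f ♯
    ; op      = λ g → op (value g)
    }
    where open Algebra A

  IsLocallyLaverLike : Algebra τ → Set ℓ
  IsLocallyLaverLike A =
    ∀ (U : List E) (W : List F) (G : List (Algebra.Carrier A)) →
    IsLaverLike (generatedSubalgebra (reduct A U W) G)

------------------------------------------------------------------------
-- Terms over 𝒢 = { f_x ∣ f ∈ E , x ∈ X } ∪ F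

-- sym f x ts is f_x(ts).

data Term (τ : Type ℓ) (X : Set ℓ) : Set ℓ where
  var : X → Term τ X
  sym : (f : Type.E τ) → X → Vec (Term τ X) (Type.nE τ f) → Term τ X
  fun : (g : Type.F τ) → Vec (Term τ X) (Type.nF τ g) → Term τ X

module _ {τ : Type ℓ} {X : Set ℓ}
         (Y : Pred X ℓ) (U : Pred (Type.E τ) ℓ) (W : Pred (Type.F τ) ℓ) where

  data TermsOver : Pred (Term τ X) ℓ where
    var : ∀ {x} → x ∈ Y → TermsOver (var x)
    sym : ∀ {f x ts} → f ∈ U → x ∈ Y → All TermsOver ts → TermsOver (sym f x ts)
    fun : ∀ {g ts} → g ∈ W → All TermsOver ts → TermsOver (fun g ts)

  -- The standing conditions on a set of terms whose operability is discussed.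

  record IsAdmissible (L : Pred (Term τ X) ℓ) : Set ℓ where
    field
      terms     : ∀ {t} → t ∈ L → t ∈ TermsOver
      subterms♯ : ∀ {f x ts} → sym f x ts ∈ L → All L ts
      subterms  : ∀ {g ts} → fun g ts ∈ L → All L ts
      variables : ∀ {x} → x ∈ Y → var x ∈ L
      closed    : ∀ {g ts} → g ∈ W → All L ts → fun g ts ∈ L
      exchange  : ∀ {f x y ts} → x ∈ Y → y ∈ Y → sym f x ts ∈ L → sym f y ts ∈ L

------------------------------------------------------------------------
-- Ordinal ranks

-- sup A o denotes the least ordinal greater than all the ordinals o a.
-- Different trees may denote the same ordinal; the definitions below depend
-- on the denoted ordinal only.

data Ord (ℓ : Level) : Set (lsuc ℓ) where
  sup : (A : Set ℓ) → (A → Ord ℓ) → Ord ℓ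

IsZero : Ord ℓ → Set ℓ
IsZero (sup A _) = ¬ A

-- L is a set of terms with variables in Y.  Partial functions are given by
-- their graphs.  Ω is the set of pairs (f , ℓs) with f among the symbols in use
-- and all ℓs in L.  The definitions below make sense for arbitrary pairs, but
-- when L is admissible the recursion started at an element of Ω, applied to an
-- element of L, stays inside Ω and L.

module Rank {τ : Type ℓ} {X : Set ℓ} (Y : Pred X ℓ) (L : Pred (Term τ X) ℓ) where
  open Type τ

  Pair : Set ℓ
  Pair = Σ[ f ∈ E ] Vec (Term τ X) (nE f)

  -- The graph of Q for w = (g , ℓs), where R (f , us) t r says that (f , us)
  -- already has a rank and f ♯ (us , t) = r.

  data Q (R : Pair → Term τ X → Term τ X → Set ℓ) (w : Pair) :
         Term τ X → Term τ X → Set ℓ where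
    var : ∀ {x} → Q R w (var x) (sym (proj₁ w) x (proj₂ w))
    fun : ∀ {g us rs} → Pointwise (Q R w) us rs → Q R w (fun g us) (fun g rs)
    sym : ∀ {f x us rs r} → Pointwise (Q R w) us rs →
          R (f , rs) (sym (proj₁ w) x (proj₂ w)) r → Q R w (sym f x us) r

  -- HasRank α w : the rank of w is α.  RankBelow α w : w has a rank < α.
  -- Apply α (f , ℓs) t r : (f , ℓs) has rank α and f ♯ (ℓs , t) = r;
  -- ApplyBelow α is the same for a rank < α.

  HasRank RankBelow Rank₀ Rank₊ : Ord ℓ → Pair → Set ℓ
  Apply ApplyBelow : Ord ℓ → Pair → Term τ X → Term τ X → Set ℓ

  HasRank α w = Rank₀ α w ⊎ Rank₊ α w

  Rank₀ α (f , ℓs) = IsZero α × (∀ x → x ∈ Y → sym f x ℓs ∉ L)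

  Rank₊ α w = ¬ IsZero α × ¬ RankBelow α w ×
              (∀ t → t ∈ L → ∃[ r ] Q (ApplyBelow α) w t r)

  RankBelow (sup A o) w = Σ[ a ∈ A ] (RankBelow (o a) w ⊎ HasRank (o a) w)

  Apply α w t r = (Rank₀ α w × r ≡ t) ⊎ (Rank₊ α w × Q (ApplyBelow α) w t r)

  ApplyBelow (sup A o) w t r =
    Σ[ a ∈ A ] (ApplyBelow (o a) w t r ⊎ Apply (o a) w t r)

------------------------------------------------------------------------
-- Operability and Laver tables

module _ {τ : Type ℓ} {X : Set ℓ} where
  open Type τ

  record IsOperable (Y : Pred X ℓ) (U : Pred E ℓ) (W : Pred F ℓ)
                    (L : Pred (Term τ X) ℓ) : Set (lsuc ℓ) where
    field
      admissible : IsAdmissible Y U W L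
      ranked     : ∀ f → f ∈ U → ∀ ℓs → All L ℓs → ∃[ α ] Rank.HasRank Y L α (f , ℓs)

  Everything : {A : Set ℓ} → Pred A ℓ
  Everything _ = ⊤

  Operable : Pred (Term τ X) ℓ → Set (lsuc ℓ)
  Operable = IsOperable Everything Everything Everything

  module _ (L : Pred (Term τ X) ℓ) where

    Part : List X → List E → List F → Pred (Term τ X) ℓ
    Part Y U W = L ∩ TermsOver (List._∈ Y) (List._∈ U) (List._∈ W)

    record LocallyOperable : Set (lsuc ℓ) where
      field
        admissible : IsAdmissible Everything Everything Everything L
        parts      : ∀ Y U W → IsOperable (List._∈ Y) (List._∈ U) (List._∈ W) (Part Y U W)

    -- The operations obtained by fitting together the operations g ♯ of the
    -- sets L_{Y,U,W}.  As all arguments lie in some L_{Y,U,W}, they are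
    -- determined by the condition restricts.

    record FittedOperations : Set (lsuc ℓ) where
      field
        _♯        : (g : E) → Vec [ t ∈ Term τ X ∣ L t ] (nE g) →
                    [ t ∈ Term τ X ∣ L t ] → [ t ∈ Term τ X ∣ L t ]
        restricts : ∀ Y U W g → g List.∈ U → ∀ ℓs t →
                    All (Part Y U W) (values ℓs) → Part Y U W (value t) →
                    ∃[ α ] Rank.Apply (List._∈ Y) (Part Y U W) α
                             (g , values ℓs) (value t) (value ((g ♯) ℓs t))

    -- The partially pre-endomorphic Laver table of a locally operable set.

    table : LocallyOperable → FittedOperations → Algebra τ
    table lo ops = record
      { Carrier = [ t ∈ Term τ X ∣ L t ]
      ; _♯      = FittedOperations._♯ ops
      ; op      = λ g ts → fun g (values ts)
                         , Irrelevant.map (IsAdmissible.closed admissible _) (proofs ts)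
      }
      where open LocallyOperable lo

    IsPartiallyEndomorphicLaverTable : LocallyOperable → FittedOperations → Set ℓ
    IsPartiallyEndomorphicLaverTable lo ops = IsPartiallyEndomorphic (table lo ops)

------------------------------------------------------------------------
-- The set L and the mapping φ : L → V

module Construction {τ : Type ℓ} (𝓥 : Algebra τ) {X : Set ℓ}
                    (v : X → Algebra.Carrier 𝓥) where
  open Algebra 𝓥

  -- value-at t is φ(t); its value does not depend on the proof that t ∈ L.

  L  : Pred (Term τ X) ℓ
  Ls : ∀ {n} → Pred (Vec (Term τ X) n) ℓ
  value-at  : ∀ t → .(L t) → Carrier
  values-at : ∀ {n} (ts : Vec (Term τ X) n) → .(Ls ts) → Vec Carrier n

  L (var x)      = ⊤
  L (fun g ts)   = Ls ts
  L (sym f x ts) = Σ[ p ∈ Ls ts ] (f , values-at ts p) ∉ Li (hull* 𝓥)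

  Ls []       = ⊤
  Ls (t ∷ ts) = L t × Ls ts

  value-at (var x)      p = v x
  value-at (fun g ts)   p = op g (values-at ts p)
  value-at (sym f x ts) p = (f ♯) (values-at ts (proj₁ p)) (v x)

  values-at []       p = []
  values-at (t ∷ ts) p = value-at t (proj₁ p) ∷ values-at ts (proj₂ p)

  φ : [ t ∈ Term τ X ∣ L t ] → Carrier
  φ (t , [ p ]) = value-at t p

-- If E is inhabited and n_f = 0 for all f ∈ E, then Li of the hull is the whole
-- hull whatever the operations f ♯ are.  Every f ♯ is then the identity on L
-- but need not be so on 𝓥, hence φ need not be a homomorphism.

Nondegenerate : Type ℓ → Set ℓ
Nondegenerate τ = E → ∃[ f ] 0 < nE f
  where open Type τ

-- Extend φ to all terms by its defining formula.  Everything rests on the relation b ≺ a on the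
-- hull, which holds if b = a * c for some c and a is not in Li: an infinite descending chain is a
-- sequence of left products avoiding Li, so Laver-likeness makes ≺ well-founded.  For a finite
-- part of L the values generate a subalgebra of a finite reduct; since z ∈ Li of its hull is
-- idempotent, the constant sequence z in larger subalgebras shows that z is in Li of the whole
-- hull, so ≺ is well-founded there too.  If Q is defined at the arguments u of f_x(u), then the
-- pair (f , Q(u)) has the value w * (f , u), where w is the pair to be ranked; hence ranks exist
-- by recursion along ≺.  The operations f ♯ are described by a relation that mentions neither
-- ranks nor parts, so they fit together, φ is a homomorphism, and distributivity follows by
-- induction along ≺.

module Submission where

open import Defs
open import Level using (Level; suc; Lift; lift; lower)
open import Axiom.ExcludedMiddle using (ExcludedMiddle)
open import Data.Empty.Polymorphic using (⊥)
open import Data.Irrelevant using ([_])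
import Data.Irrelevant as Irrelevant
open import Data.List.Base as List using (List; []; _∷_; _++_)
open import Data.List.Membership.Propositional using () renaming (_∈_ to _∈ˡ_)
open import Data.List.Membership.Propositional.Properties using (∈-++⁺ˡ; ∈-++⁺ʳ; ∈-map⁺)
open import Data.List.Relation.Binary.Subset.Propositional using () renaming (_⊆_ to _⊆ˡ_)
open import Data.List.Relation.Unary.Any using (here; there)
open import Data.Maybe.Base using (Maybe; just; nothing)
open import Data.Nat.Base as ℕ using (ℕ; zero; _<_; z<s)
open import Data.Product.Base using (Σ-syntax; ∃-syntax; _×_; _,_; proj₁; proj₂)
open import Data.Product.Properties.WithK using (,-injectiveʳ)
open import Data.Refinement.Base using (Refinement-syntax; _,_; value)
open import Data.Refinement.Properties using (value-injective)
open import Data.Sum.Base using (_⊎_; inj₁; inj₂)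
open import Data.Unit.Polymorphic.Base using (tt)
open import Data.Vec.Base as Vec using (Vec; []; _∷_; map; head; tail; replicate; toList)
open import Data.Vec.Properties using (map-∘)
open import Data.Vec.Relation.Binary.Pointwise.Inductive using (Pointwise; []; _∷_)
open import Data.Vec.Relation.Unary.All as All using (All; []; _∷_)
import Data.Vec.Relation.Unary.All.Properties as All
open import Function.Base using (_∘_; id)
open import Induction.WellFounded using (Acc; acc)
open import Relation.Binary.PropositionalEquality
  using (_≡_; refl; trans; cong; cong₂; subst; module ≡-Reasoning) renaming (sym to ≡-sym)
open import Relation.Nullary.Decidable.Core as Dec
  using (Dec; yes; no; recompute; decidable-stable)
open import Relation.Nullary.Negation.Core using (¬_; contradiction)
open import Relation.Unary using (Pred; _∈_; _∉_; _⊆_)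

private
  variable
    ℓ : Level
    n : ℕ

-- Well-foundedness from nilpotent left products.

module _ {Z : Set ℓ} (_*_ : Z → Z → Z) (S : Pred Z ℓ) where

  -- Only the factors are confined to `S`; `Li` refers to all of `Z`. For a finite part of `L` the
  -- factors come from a subhull while triviality is judged in the whole hull.
  NilpotentOn : Set ℓ
  NilpotentOn = ∀ (z : ℕ → Z) → (∀ n → S (z n)) → ∃[ n ] leftProduct _*_ z n ∈ Li _*_

  Multiple : Z → Z → Set ℓ
  Multiple b a = a ∉ Li _*_ × (Σ[ c ∈ Z ] S c × b ≡ a * c)

  module _ (em : ExcludedMiddle ℓ) (nilpotent : NilpotentOn) where

    -- A non-accessible element lies outside `Li` and has a non-accessible multiple by an element of
    -- `S`. Iterating from `a`, with `a` itself as factor zero, makes the chain equal to the left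
    -- products of the chosen factors, so no left product is in `Li`.
    nilpotent⇒accessible : ∀ {a} → S a → Acc Multiple a
    nilpotent⇒accessible {a} a∈S = decidable-stable em λ ¬acc →
      let n , li = nilpotent (factors ¬acc) (factors∈S ¬acc)
      in  proj₁ (proj₂ (extend (states ¬acc n))) (subst (_∈ Li _*_) (product ¬acc n) li)
      where
      State : Set ℓ
      State = Σ[ b ∈ Z ] ¬ Acc Multiple b

      extend : ((b , _) : State) →
               Σ[ c ∈ Z ] b ∉ Li _*_ × S c × ¬ Acc Multiple (b * c)
      extend (b , ¬acc) = decidable-stable em λ ¬step → ¬acc (acc λ where
        (b∉Li , c , c∈S , refl) →
          decidable-stable em λ ¬acc′ → ¬step (c , b∉Li , c∈S , ¬acc′))

      next : State → State
      next s = let c , _ , _ , ¬acc = extend s in proj₁ s * c , ¬acc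

      states : ¬ Acc Multiple a → ℕ → State
      states ¬acc zero      = a , ¬acc
      states ¬acc (ℕ.suc n) = next (states ¬acc n)

      factors : ¬ Acc Multiple a → ℕ → Z
      factors ¬acc zero      = a
      factors ¬acc (ℕ.suc n) = proj₁ (extend (states ¬acc n))

      factors∈S : (¬acc : ¬ Acc Multiple a) → ∀ n → S (factors ¬acc n)
      factors∈S ¬acc zero      = a∈S
      factors∈S ¬acc (ℕ.suc n) = proj₁ (proj₂ (proj₂ (extend (states ¬acc n))))

      product : (¬acc : ¬ Acc Multiple a) → ∀ n →
                leftProduct _*_ (factors ¬acc) n ≡ proj₁ (states ¬acc n)
      product ¬acc zero      = refl
      product ¬acc (ℕ.suc n) = cong (_* factors ¬acc (ℕ.suc n)) (product ¬acc n)

leftProduct-idempotent : {Z : Set ℓ} (_*_ : Z → Z → Z) {z : Z} → z * z ≡ z → ∀ n →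
                         leftProduct _*_ (λ _ → z) n ≡ z
leftProduct-idempotent _*_     eq zero      = refl
leftProduct-idempotent _*_ {z} eq (ℕ.suc n) =
  trans (cong (_* z) (leftProduct-idempotent _*_ eq n)) eq

All⇒refinement : {A : Set ℓ} {P : Pred A ℓ} {xs : Vec A n} → All P xs →
                 Σ[ ys ∈ Vec [ x ∈ A ∣ P x ] n ] values ys ≡ xs
All⇒refinement []         = [] , refl
All⇒refinement (px ∷ pxs) =
  let ys , eq = All⇒refinement pxs in ((_ , [ px ]) ∷ ys) , cong (_ ∷_) eq

recompute-All : ExcludedMiddle ℓ → {A : Set ℓ} {P : Pred A ℓ} (xs : Vec [ x ∈ A ∣ P x ] n) →
                All P (values xs)
recompute-All em []                 = []
recompute-All em ((_ , [ p ]) ∷ xs) = recompute em p ∷ recompute-All em xs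

All-toList : {A : Set ℓ} (xs : Vec A n) → All (_∈ˡ toList xs) xs
All-toList []       = []
All-toList (x ∷ xs) = here refl ∷ All.map there (All-toList xs)

-- Hulls of finitely generated subalgebras.

module _ {τ : Type ℓ} (𝓥 : Algebra τ) where
  open Type τ
  open Algebra 𝓥

  Generatedʳ : List E → List F → List Carrier → Pred Carrier ℓ
  Generatedʳ U W G = Generated (reduct 𝓥 U W) G

  Generated-mono  : ∀ {U U′ W G G′} → U ⊆ˡ U′ → G ⊆ˡ G′ → Generatedʳ U W G ⊆ Generatedʳ U′ W G′
  Generated-mono* : ∀ {U U′ W G G′} → U ⊆ˡ U′ → G ⊆ˡ G′ → {as : Vec Carrier n} →
                    All (Generatedʳ U W G) as → All (Generatedʳ U′ W G′) as
  Generated-mono U⊆ G⊆ (gen a∈G) = gen (G⊆ a∈G)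
  Generated-mono U⊆ G⊆ (♯-c (f , f∈U) as a) =
    ♯-c (f , Irrelevant.map U⊆ f∈U) (Generated-mono* U⊆ G⊆ as) (Generated-mono U⊆ G⊆ a)
  Generated-mono U⊆ G⊆ (op-c g as) = op-c g (Generated-mono* U⊆ G⊆ as)
  Generated-mono* U⊆ G⊆ []       = []
  Generated-mono* U⊆ G⊆ (a ∷ as) = Generated-mono U⊆ G⊆ a ∷ Generated-mono* U⊆ G⊆ as

  SubHull : List E → List F → List Carrier → Set ℓ
  SubHull U W G = Hull (generatedSubalgebra (reduct 𝓥 U W) G)

  -- The image of `include`, described without irrelevant proofs.
  InSubHull : List E → List F → List Carrier → Pred (Hull 𝓥) ℓ
  InSubHull U W G (f , as) = f ∈ˡ U × All (Generatedʳ U W G) as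

  module _ {U : List E} {W : List F} {G : List Carrier} where

    sub* : SubHull U W G → SubHull U W G → SubHull U W G
    sub* = hull* (generatedSubalgebra (reduct 𝓥 U W) G)

    include : SubHull U W G → Hull 𝓥
    include (f , as) = value f , values as

    include-* : ∀ z w → include (sub* z w) ≡ hull* 𝓥 (include z) (include w)
    include-* (f , as) (g , bs) = cong (value g ,_)
      (trans (≡-sym (map-∘ value _ bs)) (map-∘ _ value bs))

    include-leftProduct : ∀ {z : ℕ → SubHull U W G} {w} → (∀ n → include (z n) ≡ w n) → ∀ n →
                          include (leftProduct sub* z n) ≡ leftProduct (hull* 𝓥) w n
    include-leftProduct eq zero      = eq zero
    include-leftProduct {z} eq (ℕ.suc n) =
      trans (include-* (leftProduct sub* z n) (z (ℕ.suc n)))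
            (cong₂ (hull* 𝓥) (include-leftProduct eq n) (eq (ℕ.suc n)))

    include-onto : ∀ {w} → InSubHull U W G w → Σ[ z ∈ SubHull U W G ] include z ≡ w
    include-onto (f∈U , as) =
      let bs , eq = All⇒refinement as in ((_ , [ f∈U ]) , bs) , cong (_ ,_) eq

    include-∈ : ExcludedMiddle ℓ → ∀ z → InSubHull U W G (include z)
    include-∈ em ((f , [ f∈U ]) , as) = recompute em f∈U , recompute-All em as

    -- The product keeps the symbol of its right factor, so only the vectors have to be compared,
    -- and irrelevance of membership proofs makes equality of values enough.
    Li-include⁺ : ∀ z → include z ∈ Li (hull* 𝓥) → z ∈ Li sub*
    Li-include⁺ z li w@(g , bs) = cong (g ,_) (values-injective _ bs
        (,-injectiveʳ (trans (include-* z w) (li (include w)))))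
      where
      values-injective : ∀ {n} {P : Pred Carrier ℓ} (xs ys : Vec [ x ∈ Carrier ∣ P x ] n) →
                         values xs ≡ values ys → xs ≡ ys
      values-injective []       []       _  = refl
      values-injective (x ∷ xs) (y ∷ ys) eq =
        cong₂ _∷_ (value-injective (cong head eq)) (values-injective xs ys (cong tail eq))

  module _ (em : ExcludedMiddle ℓ) (locally : IsLocallyLaverLike 𝓥) where

    Li-include⁻ : ∀ {U W G} (z : SubHull U W G) → z ∈ Li sub* → include z ∈ Li (hull* 𝓥)
    Li-include⁻ {U} {W} {G} z li (t , ys) =
      let f∈U , as = include-∈ em z
          U′ = t ∷ U
          G′ = toList ys ++ G
          z′ , z′≡ = include-onto {U′} {W} {G′}
                       (there f∈U , Generated-mono* there (∈-++⁺ʳ (toList ys)) as)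
          y′ , y′≡ = include-onto {U′} {W} {G′}
                       (here refl , All.map (gen ∘ ∈-++⁺ˡ) (All-toList ys))
          -- All left products of the constant sequence have the value of `z`, so nilpotence yields
          -- an element of `Li` of the larger subhull with that value.
          n , li′ = LaverLike.nilpotence (locally U′ W G′) (λ _ → z′)
          idem = trans (≡-sym (include-* z z)) (cong include (li z))
          p = leftProduct sub* (λ _ → z′) n
          p≡ = trans (include-leftProduct (λ _ → z′≡) n)
                     (leftProduct-idempotent (hull* 𝓥) idem n)
      in begin
        hull* 𝓥 (include z) (t , ys)              ≡⟨ cong₂ (hull* 𝓥) p≡ y′≡ ⟨
        hull* 𝓥 (include p) (include y′)          ≡⟨ include-* p y′ ⟨
        include (sub* p y′)                       ≡⟨ cong include (li′ y′) ⟩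
        include y′                                ≡⟨ y′≡ ⟩
        (t , ys)                                  ∎
      where open ≡-Reasoning

    InSubHull-nilpotent : ∀ U W G → NilpotentOn (hull* 𝓥) (InSubHull U W G)
    InSubHull-nilpotent U W G z z∈ =
      let z′ = λ n → include-onto (z∈ n)
          n , li = LaverLike.nilpotence (locally U W G) (proj₁ ∘ z′)
      in n , subst (_∈ Li (hull* 𝓥)) (include-leftProduct (proj₂ ∘ z′) n)
           (Li-include⁻ (leftProduct sub* (proj₁ ∘ z′) n) li)

    -- Two hull elements involve finitely many symbols and entries, so both live in one subhull,
    -- where the left ideal property is available; membership in `Li` is carried down and back up.
    Li-leftIdeal : ∀ z w → w ∈ Li (hull* 𝓥) → hull* 𝓥 z w ∈ Li (hull* 𝓥)
    Li-leftIdeal (f , as) (g , bs) li =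
      let U = f ∷ g ∷ []
          G = toList as ++ toList bs
          z′ , z′≡ = include-onto {U} {[]} {G}
                       (here refl , All.map (gen ∘ ∈-++⁺ˡ) (All-toList as))
          w′ , w′≡ = include-onto {U} {[]} {G}
                       (there (here refl) , All.map (gen ∘ ∈-++⁺ʳ (toList as)) (All-toList bs))
          li′ = LaverLike.leftIdeal (locally U [] G) z′ w′
                  (Li-include⁺ w′ (subst (_∈ Li (hull* 𝓥)) (≡-sym w′≡) li))
      in subst (_∈ Li (hull* 𝓥)) (trans (include-* z′ w′) (cong₂ (hull* 𝓥) z′≡ w′≡))
           (Li-include⁻ (sub* z′ w′) li′)

-- Terms, their values and the finite parts of `L`.

module Evaluation {τ : Type ℓ} (𝓥 : Algebra τ) {X : Set ℓ} (v : X → Algebra.Carrier 𝓥) where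
  open Type τ
  open Algebra 𝓥
  open Construction 𝓥 v

  private
    _*_ = hull* 𝓥

  -- The formula for φ makes sense on all terms, which avoids carrying membership proofs.

  ⟦_⟧  : Term τ X → Carrier
  ⟦_⟧* : Vec (Term τ X) n → Vec Carrier n
  ⟦ var x ⟧      = v x
  ⟦ fun g ts ⟧   = op g ⟦ ts ⟧*
  ⟦ sym f x ts ⟧ = (f ♯) ⟦ ts ⟧* (v x)
  ⟦ [] ⟧*        = []
  ⟦ t ∷ ts ⟧*    = ⟦ t ⟧ ∷ ⟦ ts ⟧*

  value-at-⟦⟧  : ∀ t .(p : L t) → value-at t p ≡ ⟦ t ⟧
  values-at-⟦⟧ : (ts : Vec (Term τ X) n) .(p : Ls ts) → values-at ts p ≡ ⟦ ts ⟧*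
  value-at-⟦⟧ (var x)      p = refl
  value-at-⟦⟧ (fun g ts)   p = cong (op g) (values-at-⟦⟧ ts p)
  value-at-⟦⟧ (sym f x ts) p = cong (λ as → (f ♯) as (v x)) (values-at-⟦⟧ ts (proj₁ p))
  values-at-⟦⟧ []       p = refl
  values-at-⟦⟧ (t ∷ ts) p = cong₂ _∷_ (value-at-⟦⟧ t (proj₁ p)) (values-at-⟦⟧ ts (proj₂ p))

  φ-⟦⟧ : ∀ t → φ t ≡ ⟦ value t ⟧
  φ-⟦⟧ (t , [ p ]) = value-at-⟦⟧ t p

  map-φ-⟦⟧ : (ts : Vec [ t ∈ Term τ X ∣ L t ] n) → map φ ts ≡ ⟦ values ts ⟧*
  map-φ-⟦⟧ []       = refl
  map-φ-⟦⟧ (t ∷ ts) = cong₂ _∷_ (φ-⟦⟧ t) (map-φ-⟦⟧ ts)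

  Pair : Set ℓ
  Pair = Σ[ f ∈ E ] Vec (Term τ X) (nE f)

  ⟦_⟧ₚ : Pair → Hull 𝓥
  ⟦ f , ts ⟧ₚ = f , ⟦ ts ⟧*

  -- For `ts` in `L` and any `x`, nontriviality of `(f , ts)` is exactly what puts `sym f x ts` into
  -- `L`. Hence the trivial pairs are those of rank zero, as long as some variable is in use.
  Trivial : Pred Pair ℓ
  Trivial w = ⟦ w ⟧ₚ ∈ Li _*_

  node : Pair → X → Term τ X
  node (f , ts) x = sym f x ts

  Ls⇒All : {ts : Vec (Term τ X) n} → Ls ts → All L ts
  Ls⇒All {ts = []}     _        = []
  Ls⇒All {ts = t ∷ ts} (p , ps) = p ∷ Ls⇒All ps

  All⇒Ls : {ts : Vec (Term τ X) n} → All L ts → Ls ts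
  All⇒Ls []       = tt
  All⇒Ls (p ∷ ps) = p , All⇒Ls ps

  node∈L⁺ : ∀ {f x ts} → All L ts → (f , ts) ∉ Trivial → L (sym f x ts)
  node∈L⁺ {f} {x} {ts} ps ∉Li =
    All⇒Ls ps , ∉Li ∘ subst (λ as → (f , as) ∈ Li _*_) (values-at-⟦⟧ ts (All⇒Ls ps))

  node∈L⁻ : ∀ {f x ts} → L (sym f x ts) → All L ts × (f , ts) ∉ Trivial
  node∈L⁻ {f} {x} {ts} (ps , ∉Li) =
    Ls⇒All ps , ∉Li ∘ subst (λ as → (f , as) ∈ Li _*_) (≡-sym (values-at-⟦⟧ ts ps))

  Full : {A : Set ℓ} → Pred A ℓ
  Full = Everything {τ = τ} {X = X}

  L-admissible : IsAdmissible Full Full Full L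
  L-admissible = record
    { terms     = λ {t} _ → over t
    ; subterms♯ = λ {_ x} p → proj₁ (node∈L⁻ {x = x} p)
    ; subterms  = Ls⇒All
    ; variables = λ _ → tt
    ; closed    = λ _ → All⇒Ls
    ; exchange  = λ _ _ → id
    }
    where
    over  : ∀ t → TermsOver Full Full Full t
    overs : (ts : Vec (Term τ X) n) → All (TermsOver Full Full Full) ts
    over (var x)      = var tt
    over (fun g ts)   = fun tt (overs ts)
    over (sym f x ts) = sym tt tt (overs ts)
    overs []       = []
    overs (t ∷ ts) = over t ∷ overs ts

  Part-admissible : ∀ Y U W → IsAdmissible (_∈ˡ Y) (_∈ˡ U) (_∈ˡ W) (Part L Y U W)
  Part-admissible Y U W = record
    { terms     = proj₂
    ; subterms♯ = λ { {x = x} (p , sym _ _ os) → All.zip (proj₁ (node∈L⁻ {x = x} p) , os) }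
    ; subterms  = λ { (p , fun _ os) → All.zip (Ls⇒All p , os) }
    ; variables = λ x∈Y → tt , var x∈Y
    ; closed    = λ g∈W ps → All⇒Ls (All.map proj₁ ps) , fun g∈W (All.map proj₂ ps)
    ; exchange  = λ { _ y∈Y (p , sym f∈U _ os) → p , sym f∈U y∈Y os }
    }

  node∈Part : ∀ {Y U W f x ts} → f ∈ˡ U → x ∈ˡ Y → All (Part L Y U W) ts →
              (f , ts) ∉ Trivial → Part L Y U W (sym f x ts)
  node∈Part {x = x} f∈U x∈Y ps ¬t =
    node∈L⁺ {x = x} (All.map proj₁ ps) ¬t , sym f∈U x∈Y (All.map proj₂ ps)

  TermsOver⇒Generated  : ∀ {Y U W t} → TermsOver (_∈ˡ Y) (_∈ˡ U) (_∈ˡ W) t →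
                         Generatedʳ 𝓥 U W (List.map v Y) ⟦ t ⟧
  TermsOver⇒Generated* : ∀ {Y U W} {ts : Vec (Term τ X) n} →
                         All (TermsOver (_∈ˡ Y) (_∈ˡ U) (_∈ˡ W)) ts →
                         All (Generatedʳ 𝓥 U W (List.map v Y)) ⟦ ts ⟧*
  TermsOver⇒Generated (var x∈Y)        = gen (∈-map⁺ v x∈Y)
  TermsOver⇒Generated (sym f∈U x∈Y os) =
    ♯-c (_ , [ f∈U ]) (TermsOver⇒Generated* os) (gen (∈-map⁺ v x∈Y))
  TermsOver⇒Generated (fun g∈W os)     = op-c (_ , [ g∈W ]) (TermsOver⇒Generated* os)
  TermsOver⇒Generated* []       = []
  TermsOver⇒Generated* (o ∷ os) = TermsOver⇒Generated o ∷ TermsOver⇒Generated* os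

  TermsOver-mono  : {Y Y′ : List X} {U U′ : List E} {W W′ : List F} →
                    Y ⊆ˡ Y′ → U ⊆ˡ U′ → W ⊆ˡ W′ →
                    TermsOver (_∈ˡ Y) (_∈ˡ U) (_∈ˡ W) ⊆ TermsOver (_∈ˡ Y′) (_∈ˡ U′) (_∈ˡ W′)
  TermsOver-mono* : {Y Y′ : List X} {U U′ : List E} {W W′ : List F} →
                    Y ⊆ˡ Y′ → U ⊆ˡ U′ → W ⊆ˡ W′ → {ts : Vec (Term τ X) n} →
                    All (TermsOver (_∈ˡ Y) (_∈ˡ U) (_∈ˡ W)) ts →
                    All (TermsOver (_∈ˡ Y′) (_∈ˡ U′) (_∈ˡ W′)) ts
  TermsOver-mono Y⊆ U⊆ W⊆ (var x∈Y)        = var (Y⊆ x∈Y)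
  TermsOver-mono Y⊆ U⊆ W⊆ (sym f∈U x∈Y os) = sym (U⊆ f∈U) (Y⊆ x∈Y) (TermsOver-mono* Y⊆ U⊆ W⊆ os)
  TermsOver-mono Y⊆ U⊆ W⊆ (fun g∈W os)     = fun (W⊆ g∈W) (TermsOver-mono* Y⊆ U⊆ W⊆ os)
  TermsOver-mono* Y⊆ U⊆ W⊆ []       = []
  TermsOver-mono* Y⊆ U⊆ W⊆ (o ∷ os) = TermsOver-mono Y⊆ U⊆ W⊆ o ∷ TermsOver-mono* Y⊆ U⊆ W⊆ os

  support  : ∀ t → Σ[ Y ∈ List X ] Σ[ U ∈ List E ] Σ[ W ∈ List F ]
             TermsOver (_∈ˡ Y) (_∈ˡ U) (_∈ˡ W) t
  support* : (ts : Vec (Term τ X) n) → Σ[ Y ∈ List X ] Σ[ U ∈ List E ] Σ[ W ∈ List F ]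
             All (TermsOver (_∈ˡ Y) (_∈ˡ U) (_∈ˡ W)) ts
  support (var x)      = x ∷ [] , [] , [] , var (here refl)
  support (fun g ts)   =
    let Y , U , W , os = support* ts
    in  Y , U , g ∷ W , fun (here refl) (TermsOver-mono* id id there os)
  support (sym f x ts) =
    let Y , U , W , os = support* ts
    in  x ∷ Y , f ∷ U , W , sym (here refl) (here refl) (TermsOver-mono* there there id os)
  support* []       = [] , [] , [] , []
  support* (t ∷ ts) =
    let Y , U , W , o = support t
        Y′ , U′ , W′ , os = support* ts
    in  Y ++ Y′ , U ++ U′ , W ++ W′ ,
        TermsOver-mono (∈-++⁺ˡ {ys = Y′}) (∈-++⁺ˡ {ys = U′}) (∈-++⁺ˡ {ys = W′}) o ∷
        TermsOver-mono* (∈-++⁺ʳ Y) (∈-++⁺ʳ U) (∈-++⁺ʳ W) os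

  -- The graph of the operations f ♯, without reference to ranks or to the finite parts of L:
  -- rank zero is replaced by membership in Li.

  data Eval : Pair → Term τ X → Term τ X → Set ℓ where
    triv : ∀ {w t} → w ∈ Trivial → Eval w t t
    var  : ∀ {w x} → w ∉ Trivial → Eval w (var x) (node w x)
    fun  : ∀ {w g us rs} → w ∉ Trivial → Pointwise (Eval w) us rs → Eval w (fun g us) (fun g rs)
    sym  : ∀ {w f x us rs r} → w ∉ Trivial → Pointwise (Eval w) us rs →
           Eval (f , rs) (node w x) r → Eval w (sym f x us) r

  -- The premises `w ∉ Trivial` keep the other rules from overlapping with `triv`, so pair and term
  -- determine which rule applies.
  Eval-functional  : ∀ {w t r r′} → Eval w t r → Eval w t r′ → r ≡ r′
  Eval-functional* : ∀ {w} {ts rs rs′ : Vec (Term τ X) n} → Pointwise (Eval w) ts rs →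
                     Pointwise (Eval w) ts rs′ → rs ≡ rs′
  Eval-functional (triv _)  (triv _)      = refl
  Eval-functional (triv p)  (var ¬p)      = contradiction p ¬p
  Eval-functional (triv p)  (fun ¬p _)    = contradiction p ¬p
  Eval-functional (triv p)  (sym ¬p _ _)  = contradiction p ¬p
  Eval-functional (var ¬p)  (triv p)      = contradiction p ¬p
  Eval-functional (var _)   (var _)       = refl
  Eval-functional (fun ¬p _)  (triv p)    = contradiction p ¬p
  Eval-functional (fun _ es)  (fun _ es′) = cong (fun _) (Eval-functional* es es′)
  Eval-functional (sym ¬p _ _)  (triv p)  = contradiction p ¬p
  Eval-functional (sym _ es e)  (sym _ es′ e′) with refl ← Eval-functional* es es′ =
    Eval-functional e e′
  Eval-functional* []       []         = refl
  Eval-functional* (e ∷ es) (e′ ∷ es′) = cong₂ _∷_ (Eval-functional e e′) (Eval-functional* es es′)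

  Eval-trivial* : ∀ {w} → w ∈ Trivial → (ts : Vec (Term τ X) n) → Pointwise (Eval w) ts ts
  Eval-trivial* p []       = []
  Eval-trivial* p (t ∷ ts) = triv p ∷ Eval-trivial* p ts

  -- Without symbols of positive arity all vectors in the hull are empty and every product equals
  -- its right factor. A nontrivial pair thus brings nondegeneracy with it.
  ∉Li⇒nondegenerate : ExcludedMiddle ℓ → ∀ {z} → z ∉ Li _*_ → Nondegenerate τ
  ∉Li⇒nondegenerate em {z} ∉Li _ = decidable-stable em λ ¬∃ → ∉Li λ (t , ys) →
    cong (t ,_) (nullary ys (λ 0<n → ¬∃ (t , 0<n)))
    where
    nullary : ∀ {h : Carrier → Carrier} (as : Vec Carrier n) → ¬ 0 < n → map h as ≡ as
    nullary []       _   = refl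
    nullary (_ ∷ _)  0≮n = contradiction z<s 0≮n

  -- `Li` is informative only through vectors with an entry; the test element carries `a` in a
  -- vector of positive length.
  Li⇒identity : Nondegenerate τ → ∀ {f as} → (f , as) ∈ Li _*_ → ∀ a → (f ♯) as a ≡ a
  Li⇒identity nd {f} {as} li a =
    let s , 0<n = nd f in pointwise 0<n (,-injectiveʳ (li (s , replicate (nE s) a)))
    where
    pointwise : 0 < n → map ((f ♯) as) (replicate n a) ≡ replicate n a → (f ♯) as a ≡ a
    pointwise z<s eq = cong head eq

  -- Values of evaluated terms in a partially endomorphic algebra.

  module _ (em : ExcludedMiddle ℓ) (endo : IsPartiallyEndomorphic 𝓥) where

    Eval-fun : ∀ {w g us rs} → Pointwise (Eval w) us rs → Eval w (fun g us) (fun g rs)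
    Eval-fun {w} es with em {w ∈ Trivial}
    ... | no ¬p = fun ¬p es
    ... | yes p with refl ← Eval-functional* es (Eval-trivial* p _) = triv p

    -- Induction on the derivation: the rules `fun` and `sym` mirror the endomorphism laws of `𝓥`,
    -- and nondegeneracy serves the case `triv`, where the operation has to be the identity on
    -- values.
    Eval-⟦⟧  : Nondegenerate τ → ∀ {w t r} → Eval w t r →
               ⟦ r ⟧ ≡ (proj₁ w ♯) ⟦ proj₂ w ⟧* ⟦ t ⟧
    Eval-⟦⟧* : Nondegenerate τ → ∀ {w} {ts rs : Vec (Term τ X) n} → Pointwise (Eval w) ts rs →
               ⟦ rs ⟧* ≡ map ((proj₁ w ♯) ⟦ proj₂ w ⟧*) ⟦ ts ⟧*
    Eval-⟦⟧ nd (triv p) = ≡-sym (Li⇒identity nd p _)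
    Eval-⟦⟧ nd (var _)  = refl
    Eval-⟦⟧ nd {w} (fun {g = g} _ es) =
      trans (cong (op g) (Eval-⟦⟧* nd es)) (≡-sym (IsHomomorphism.op-homo (endo _ _) g _))
    Eval-⟦⟧ nd {w} (sym {f = f} {x} _ es e) = trans (Eval-⟦⟧ nd e)
      (trans (cong (λ as → (f ♯) as ⟦ node w x ⟧) (Eval-⟦⟧* nd es))
             (≡-sym (IsHomomorphism.♯-homo (endo _ _) f _ _)))
    Eval-⟦⟧* nd []       = refl
    Eval-⟦⟧* nd (e ∷ es) = cong₂ _∷_ (Eval-⟦⟧ nd e) (Eval-⟦⟧* nd es)

    Eval-⟦⟧ₚ : ∀ {w f ts rs} → w ∉ Trivial → Pointwise (Eval w) ts rs →
               ⟦ f , rs ⟧ₚ ≡ ⟦ w ⟧ₚ * ⟦ f , ts ⟧ₚ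
    Eval-⟦⟧ₚ ¬p es = cong (_ ,_) (Eval-⟦⟧* (∉Li⇒nondegenerate em ¬p) es)

    -- Ranks on an admissible subset of `L`.

    module OnPart
      {Y : Pred X ℓ} {U : Pred E ℓ} {W : Pred F ℓ} {P : Pred (Term τ X) ℓ}
      (adm : IsAdmissible Y U W P) (P⊆L : P ⊆ L)
      (node∈P : ∀ {f x ts} → f ∈ U → x ∈ Y → All P ts → (f , ts) ∉ Trivial → P (sym f x ts))
      -- `S` contains the values of the pairs to be ranked: a subhull for a finite part, everything
      -- for `L` itself.
      {S : Pred (Hull 𝓥) ℓ} (∈S : ∀ {f ts} → f ∈ U → All P ts → S ⟦ f , ts ⟧ₚ)
      (nilpotent : NilpotentOn _*_ S) where

      open IsAdmissible adm
      open Rank Y P hiding (Pair)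

      Ω : Pred Pair ℓ
      Ω (f , ts) = f ∈ U × All P ts

      _≺_ : Pair → Pair → Set ℓ
      w ≺ u = Multiple _*_ S ⟦ w ⟧ₚ ⟦ u ⟧ₚ

      Accessible : Pair → Set ℓ
      Accessible w = Acc (Multiple _*_ S) ⟦ w ⟧ₚ

      accessible : ∀ {w} → w ∈ Ω → Accessible w
      accessible (f∈U , ps) = nilpotent⇒accessible _*_ S em nilpotent (∈S f∈U ps)

      Eval-≺ : ∀ {w f ts rs} → w ∉ Trivial → (f , ts) ∈ Ω → Pointwise (Eval w) ts rs →
               (f , rs) ≺ w
      Eval-≺ ¬p (f∈U , ps) es = ¬p , _ , ∈S f∈U ps , Eval-⟦⟧ₚ ¬p es

      node∈P⁻ : ∀ {f x ts} → P (sym f x ts) → (f , ts) ∈ Ω × x ∈ Y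
      node∈P⁻ p with sym f∈U x∈Y _ ← terms p = (f∈U , subterms♯ p) , x∈Y

      fun∈P⁻ : ∀ {g ts} → P (fun g ts) → g ∈ W × All P ts
      fun∈P⁻ p with fun g∈W _ ← terms p = g∈W , subterms p

      var∈P⁻ : ∀ {x} → P (var x) → x ∈ Y
      var∈P⁻ p with var x∈Y ← terms p = x∈Y

      node∈Ω : ∀ {w x} → w ∈ Ω → x ∈ Y → w ∉ Trivial → P (node w x)
      node∈Ω (f∈U , ps) x∈Y = node∈P f∈U x∈Y ps

      -- Induction on the derivation, before any rank is known to exist. This keeps the pairs formed
      -- from computed arguments inside `Ω`.
      Eval∈P  : ∀ {w t r} → w ∈ Ω → P t → Eval w t r → P r
      Eval∈P* : ∀ {w} {ts rs : Vec (Term τ X) n} → w ∈ Ω → All P ts →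
                Pointwise (Eval w) ts rs → All P rs
      Eval∈P ω p (triv _)     = p
      Eval∈P ω p (var ¬t)     = node∈Ω ω (var∈P⁻ p) ¬t
      Eval∈P ω p (fun _ es)   = let g∈W , ps = fun∈P⁻ p in closed g∈W (Eval∈P* ω ps es)
      Eval∈P ω p (sym ¬t es e) =
        let (f∈U , ps) , x∈Y = node∈P⁻ p
        in  Eval∈P (f∈U , Eval∈P* ω ps es) (node∈Ω ω x∈Y ¬t) e
      Eval∈P* ω []       []       = []
      Eval∈P* ω (p ∷ ps) (e ∷ es) = Eval∈P ω p e ∷ Eval∈P* ω ps es

      -- With no variables in use, w gets rank zero even if it is not trivial; then Q is the
      -- identity as well, since all terms are closed terms over F.

      Eval-closed  : (∀ x → x ∉ Y) → ∀ {w t} → w ∉ Trivial → P t → Eval w t t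
      Eval-closed* : (∀ x → x ∉ Y) → ∀ {w} {ts : Vec (Term τ X) n} → w ∉ Trivial → All P ts →
                     Pointwise (Eval w) ts ts
      Eval-closed ∅ {t = var x}      ¬t p = contradiction (var∈P⁻ p) (∅ x)
      Eval-closed ∅ {t = sym f x ts} ¬t p = contradiction (proj₂ (node∈P⁻ p)) (∅ x)
      Eval-closed ∅ {t = fun g ts}   ¬t p = fun ¬t (Eval-closed* ∅ ¬t (subterms p))
      Eval-closed* ∅ ¬t []       = []
      Eval-closed* ∅ ¬t (p ∷ ps) = Eval-closed ∅ ¬t p ∷ Eval-closed* ∅ ¬t ps

      rank₀-Eval : ∀ {w t} → w ∈ Ω → P t → (∀ x → x ∈ Y → ¬ P (node w x)) → Eval w t t
      rank₀-Eval {w} ω p none with em {w ∈ Trivial}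
      ... | yes t = triv t
      ... | no ¬t = Eval-closed (λ x x∈Y → none x x∈Y (node∈Ω ω x∈Y ¬t)) ¬t p

      node⇒nontrivial : ∀ {w} → ¬ (∀ x → x ∈ Y → ¬ P (node w x)) → w ∉ Trivial
      node⇒nontrivial some t = some λ x _ p → proj₂ (node∈L⁻ {x = x} (P⊆L p)) t

      -- A trivial `w` has no node in `P` and so rank zero, a rank below `α`, which positive rank
      -- forbids. Zero need not be an immediate branch of the tree, so the search descends until a
      -- branch denotes it.
      rank₊-nontrivial : ∀ {α w} → Rank₊ α w → w ∉ Trivial
      rank₊-nontrivial (¬zero , ¬below , _) = node⇒nontrivial λ none →
        ¬below (zero-below _ ¬zero none)
        where
        zero-below : ∀ α {w} → ¬ IsZero α → (∀ x → x ∈ Y → ¬ P (node w x)) → RankBelow α w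
        zero-below (sup A o) ¬zero none = decidable-stable em λ ¬below → ¬zero λ a →
          ¬below (a , zero-at (o a) none)
          where
          zero-at : ∀ β {w} → (∀ x → x ∈ Y → ¬ P (node w x)) → RankBelow β w ⊎ HasRank β w
          zero-at β none with em {IsZero β}
          ... | yes z = inj₂ (inj₁ (z , none))
          ... | no ¬z = inj₁ (zero-below β ¬z none)

      -- Recursion on the ordinal tree and the graph of `Q`. Membership in `Ω` and `P` is carried
      -- along because `rank₀-Eval` matches the identity at rank zero with `Eval` there.
      Apply⇒Eval      : ∀ α {w t r} → w ∈ Ω → P t → Apply α w t r → Eval w t r
      ApplyBelow⇒Eval : ∀ α {w t r} → w ∈ Ω → P t → ApplyBelow α w t r → Eval w t r
      Q⇒Eval  : ∀ α {w t r} → w ∈ Ω → w ∉ Trivial → P t → Q (ApplyBelow α) w t r → Eval w t r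
      Q⇒Eval* : ∀ α {w} {ts rs : Vec (Term τ X) n} → w ∈ Ω → w ∉ Trivial → All P ts →
                Pointwise (Q (ApplyBelow α) w) ts rs → Pointwise (Eval w) ts rs
      Apply⇒Eval α ω p (inj₁ ((_ , none) , refl)) = rank₀-Eval ω p none
      Apply⇒Eval α ω p (inj₂ (rank₊ , q))         = Q⇒Eval α ω (rank₊-nontrivial rank₊) p q
      ApplyBelow⇒Eval (sup A o) ω p (a , inj₁ q) = ApplyBelow⇒Eval (o a) ω p q
      ApplyBelow⇒Eval (sup A o) ω p (a , inj₂ q) = Apply⇒Eval (o a) ω p q
      Q⇒Eval α ω ¬t p var        = var ¬t
      Q⇒Eval α ω ¬t p (fun qs)   = fun ¬t (Q⇒Eval* α ω ¬t (subterms p) qs)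
      Q⇒Eval α ω ¬t p (sym qs q) =
        let (f∈U , ps) , x∈Y = node∈P⁻ p
            es = Q⇒Eval* α ω ¬t ps qs
        in  sym ¬t es (ApplyBelow⇒Eval α (f∈U , Eval∈P* ω ps es) (node∈Ω ω x∈Y ¬t) q)
      Q⇒Eval* α ω ¬t []       []       = []
      Q⇒Eval* α ω ¬t (p ∷ ps) (q ∷ qs) = Q⇒Eval α ω ¬t p q ∷ Q⇒Eval* α ω ¬t ps qs

      Ranked : Pair → Set (suc ℓ)
      Ranked w = ∃[ α ] HasRank α w

      below⇒ranked : ∀ α {w} → RankBelow α w → Ranked w
      below⇒ranked (sup A o) (a , inj₁ below) = below⇒ranked (o a) below
      below⇒ranked (sup A o) (a , inj₂ has)   = o a , has

      apply : ∀ α {w t} → HasRank α w → P t → ∃[ r ] Apply α w t r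
      apply α (inj₁ rank₀)                 p = _ , inj₁ (rank₀ , refl)
      apply α (inj₂ rank₊@(_ , _ , total)) p = let r , q = total _ p in r , inj₂ (rank₊ , q)

      zeroᵒ : Ord ℓ
      zeroᵒ = sup ⊥ λ ()

      -- Q is total at the least ordinal above the ranks of all u ≺ w; the index nothing keeps
      -- this ordinal positive.

      ranked-step : ∀ {w} → w ∈ Ω → (∀ {u} → u ∈ Ω → u ≺ w → Ranked u) → Ranked w
      ranked-step {w} ω rec with em {∀ x → x ∈ Y → ¬ P (node w x)}
      ... | yes none = zeroᵒ , inj₁ ((λ ()) , none)
      ... | no some  = least em
        where
        ¬t : w ∉ Trivial
        ¬t = node⇒nontrivial some

        Index : Set ℓ
        Index = Maybe (Σ[ u ∈ Pair ] u ∈ Ω × u ≺ w)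

        rank : Index → Ord ℓ
        rank nothing              = zeroᵒ
        rank (just (_ , ω′ , lt)) = proj₁ (rec ω′ lt)

        α : Ord ℓ
        α = sup Index rank

        total  : ∀ t → P t → ∃[ r ] Q (ApplyBelow α) w t r
        total* : (ts : Vec (Term τ X) n) → All P ts →
                 Σ[ rs ∈ Vec (Term τ X) n ] Pointwise (Q (ApplyBelow α) w) ts rs
        total (var x)      p = _ , var
        total (fun g ts)   p = let rs , qs = total* ts (subterms p) in _ , fun qs
        total (sym f x ts) p =
          let (f∈U , ps) , x∈Y = node∈P⁻ p
              rs , qs = total* ts ps
              -- Read as `Eval`, the computed arguments give a pair below `w`, whose rank is among
              -- the branches of `α`.
              es = Q⇒Eval* α ω ¬t ps qs
              ω′ = f∈U , Eval∈P* ω ps es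
              lt = Eval-≺ ¬t (f∈U , ps) es
              β , has = rec ω′ lt
              r , q = apply β has (node∈Ω ω x∈Y ¬t)
          in  r , sym qs (just (_ , ω′ , lt) , inj₂ q)
        total* []       []       = [] , []
        total* (t ∷ ts) (p ∷ ps) =
          let r , q = total t p
              rs , qs = total* ts ps
          in  r ∷ rs , q ∷ qs

        -- Positive rank demands that no smaller rank exists; if `w` is ranked below `α`, that rank
        -- is used instead.
        least : Dec (RankBelow α w) → Ranked w
        least (yes below) = below⇒ranked α below
        least (no ¬below) = α , inj₂ ((λ ¬i → ¬i nothing) , ¬below , total)

      ranked′ : ∀ {w} → w ∈ Ω → Accessible w → Ranked w
      ranked′ ω (acc rs) = ranked-step ω λ ω′ lt → ranked′ ω′ (rs lt)

      ranked : ∀ {w} → w ∈ Ω → Ranked w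
      ranked ω = ranked′ ω (accessible ω)

      operable : IsOperable Y U W P
      operable = record { admissible = adm ; ranked = λ f f∈U ts ps → ranked (f∈U , ps) }

      abstract
        -- No rank is built along the derivation: `w` has a rank, the value applied there is an
        -- `Eval`-value, and `Eval` is functional.
        Eval⇒Apply : ∀ {w t r} → w ∈ Ω → P t → Eval w t r → ∃[ α ] Apply α w t r
        Eval⇒Apply ω p e =
          let α , has = ranked ω
              _ , q = apply α has p
          in  α , subst (Apply α _ _) (Eval-functional (Apply⇒Eval α ω p q) e) q

        Eval-total : ∀ {w t} → w ∈ Ω → P t → ∃[ r ] Eval w t r
        Eval-total ω p =
          let α , has = ranked ω
              r , q = apply α has p
          in  r , Apply⇒Eval α ω p q

      Eval-total* : ∀ {w} {ts : Vec (Term τ X) n} → w ∈ Ω → All P ts →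
                    Σ[ rs ∈ Vec (Term τ X) n ] Pointwise (Eval w) ts rs
      Eval-total* ω []       = [] , []
      Eval-total* ω (p ∷ ps) =
        let r , e = Eval-total ω p
            rs , es = Eval-total* ω ps
        in  r ∷ rs , e ∷ es

      -- As `w` is nontrivial, evaluation at the node u_x can only use rule `sym`; inverting it
      -- exhibits w(u_x) as (w * u)(w_x).
      Eval-node : ∀ {w f us us′ x} → w ∈ Ω → (f , us) ∈ Ω → w ∉ Trivial → (f , us) ∉ Trivial →
                  x ∈ Y → Pointwise (Eval w) us us′ →
                  ∃[ r ] Eval w (sym f x us) r × Eval (f , us′) (node w x) r
      Eval-node ω υ ¬w ¬u x∈Y es with Eval-total ω (node∈Ω υ x∈Y ¬u)
      ... | _ , triv t = contradiction t ¬w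
      ... | _ , e@(sym _ es′ e′) with refl ← Eval-functional* es es′ = _ , e , e′

      -- Left distributivity.

      module _ (leftIdeal : ∀ z w → w ∈ Li _*_ → (z * w) ∈ Li _*_) where

        -- The left ideal property covers nontrivial `w`; a trivial `w` leaves the arguments
        -- unchanged.
        Trivial-* : ∀ {w f us us′} → Pointwise (Eval w) us us′ →
                    (f , us) ∈ Trivial → (f , us′) ∈ Trivial
        Trivial-* {w} es p with em {w ∈ Trivial}
        ... | no ¬t = subst (_∈ Li _*_) (≡-sym (Eval-⟦⟧ₚ ¬t es)) (leftIdeal _ _ p)
        ... | yes t with refl ← Eval-functional* es (Eval-trivial* t _) = p

        -- In hull notation w(u(t)) = (w * u)(w(t)).  For t = s_x both sides reduce to
        -- ((w * u) * (w * s))((w * u)(w_x)): the left by the instance (w , u * s , u_x), the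
        -- right by the instance (w * u , w * s , w_x), and u * s ≺ u, w * u ≺ w.

        Eval-distrib  : ∀ {w f us us′ t r₁ r₂ r₃} → Accessible w → Accessible (f , us) →
                        w ∈ Ω → (f , us) ∈ Ω → P t → Pointwise (Eval w) us us′ →
                        Eval (f , us) t r₁ → Eval w r₁ r₂ → Eval w t r₃ → Eval (f , us′) r₃ r₂
        Eval-distrib* : ∀ {w f us us′} {ts rs₁ rs₂ rs₃ : Vec (Term τ X) n} →
                        Accessible w → Accessible (f , us) →
                        w ∈ Ω → (f , us) ∈ Ω → All P ts → Pointwise (Eval w) us us′ →
                        Pointwise (Eval (f , us)) ts rs₁ → Pointwise (Eval w) rs₁ rs₂ →
                        Pointwise (Eval w) ts rs₃ → Pointwise (Eval (f , us′)) rs₃ rs₂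
        Eval-distrib aw au ω υ p es (triv t) e₂ e₃
          with refl ← Eval-functional e₂ e₃ = triv (Trivial-* es t)
        Eval-distrib aw au ω υ p es e₁ e₂ (triv t)
          with refl ← Eval-functional e₂ (triv t)
             | refl ← Eval-functional* es (Eval-trivial* t _) = e₁
        Eval-distrib aw au ω υ p es _ (triv t) (var ¬t) = contradiction t ¬t
        Eval-distrib aw au ω υ p es (var _) (sym _ es′ e₂) (var _)
          with refl ← Eval-functional* es es′ = e₂
        Eval-distrib aw au ω υ p es (fun _ _) (triv t) (fun ¬t _) = contradiction t ¬t
        Eval-distrib aw au ω υ p es (fun _ es₁) (fun _ es₂) (fun _ es₃) =
          Eval-fun (Eval-distrib* aw au ω υ (subterms p) es es₁ es₂ es₃)
        Eval-distrib (acc aw) (acc au) ω υ@(f∈U , us∈P) p es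
                     (sym ¬u es₁ e₁) e₂ (sym ¬w es₃ e₃) =
          let (h∈U , ts∈P) , x∈Y = node∈P⁻ p
              rs₁∈P = Eval∈P* υ ts∈P es₁
              rs₃∈P = Eval∈P* ω ts∈P es₃
              wu∈Ω = f∈U , Eval∈P* ω us∈P es
              us∈Ω = h∈U , rs₁∈P
              ws∈Ω = h∈U , rs₃∈P
              _ , es₂ = Eval-total* ω rs₁∈P
              _ , e , e′ = Eval-node ω υ ¬w ¬u x∈Y es
              left = Eval-distrib (acc aw) (au (Eval-≺ ¬u (h∈U , ts∈P) es₁)) ω us∈Ω
                       (node∈Ω υ x∈Y ¬u) es₂ e₁ e₂ e
              args = Eval-distrib* (acc aw) (acc au) ω υ ts∈P es es₁ es₂ es₃
              -- Totality gives w * u some value at `r₃`. Then `right` and `left` evaluate one pair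
              -- at one term, which forces this value to be `r₂`.
              _ , e₄ = Eval-total wu∈Ω (Eval∈P ws∈Ω (node∈Ω ω x∈Y ¬w) e₃)
              -- The recursion is lexicographic in w, u and the term: `left` descends in u, `args`
              -- in the term, and `right` in w, so w * s may enter with a fresh accessibility proof.
              right = Eval-distrib (aw (Eval-≺ ¬w υ es)) (accessible ws∈Ω) wu∈Ω ws∈Ω
                        (node∈Ω ω x∈Y ¬w) args e₃ e₄ e′
          in  subst (Eval _ _) (Eval-functional right left) e₄
        Eval-distrib* aw au ω υ []       es []         []         []         = []
        Eval-distrib* aw au ω υ (p ∷ ps) es (e₁ ∷ es₁) (e₂ ∷ es₂) (e₃ ∷ es₃) =
          Eval-distrib aw au ω υ p es e₁ e₂ e₃ ∷ Eval-distrib* aw au ω υ ps es es₁ es₂ es₃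

  -- Passage from the finite parts to `L`.

  Part∈InSubHull : ∀ {Y U W f ts} → f ∈ˡ U → All (Part L Y U W) ts →
                   InSubHull 𝓥 U W (List.map v Y) ⟦ f , ts ⟧ₚ
  Part∈InSubHull f∈U ps = f∈U , TermsOver⇒Generated* (All.map proj₂ ps)

  module Global (em : ExcludedMiddle ℓ) (endo : IsPartiallyEndomorphic 𝓥)
                (locally : IsLocallyLaverLike 𝓥) where

    module OnFinite (Y : List X) (U : List E) (W : List F) =
      OnPart em endo (Part-admissible Y U W) proj₁ node∈Part
             {S = InSubHull 𝓥 U W (List.map v Y)} Part∈InSubHull
             (InSubHull-nilpotent 𝓥 em locally U W (List.map v Y))

    locallyOperable : LocallyOperable L
    locallyOperable = record { admissible = L-admissible ; parts = OnFinite.operable }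

    L-proof : (t : [ t ∈ Term τ X ∣ L t ]) → L (value t)
    L-proof (_ , [ p ]) = recompute em p

    abstract
      -- Finitely many terms lie in one finite part, where totality is known once `g` is among its
      -- symbols. As `Eval` does not mention the part, the value is one for `L`.
      evaluate : ∀ g ts t → All L ts → L t → ∃[ r ] Eval (g , ts) t r × L r
      evaluate g ts t ts∈L t∈L with support* (t ∷ ts)
      ... | Y , U , W , o ∷ os = evaluateIn
            (here refl , All.zip (ts∈L , TermsOver-mono* id there id os))
            (t∈L , TermsOver-mono id there id o)
        where
        module Fin = OnFinite Y (g ∷ U) W
        evaluateIn : (g , ts) ∈ Fin.Ω → Part L Y (g ∷ U) W t → ∃[ r ] Eval (g , ts) t r × L r
        evaluateIn ω p =
          let r , e = Fin.Eval-total ω p in r , e , proj₁ (Fin.Eval∈P ω p e)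

      -- Only the inputs have to be placed in a common finite part; the values are controlled by the
      -- derivations.
      Eval-distrib-L : ∀ {g ts f us t us′ r₁ r₂ r₃} → All L ts → All L us → L t →
                       Pointwise (Eval (g , ts)) us us′ → Eval (f , us) t r₁ →
                       Eval (g , ts) r₁ r₂ → Eval (g , ts) t r₃ → Eval (f , us′) r₃ r₂
      Eval-distrib-L {g} {ts} {f} {us} {t} ts∈L us∈L t∈L with support* (t ∷ ts Vec.++ us)
      ... | Y , U , W , o ∷ os = distribIn
            (here refl ,
              All.zip (ts∈L , TermsOver-mono* id (there ∘ there) id (proj₁ (All.++⁻ ts os))))
            (there (here refl) ,
              All.zip (us∈L , TermsOver-mono* id (there ∘ there) id (proj₂ (All.++⁻ ts os))))
            (t∈L , TermsOver-mono id (there ∘ there) id o)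
        where
        module Fin = OnFinite Y (g ∷ f ∷ U) W
        distribIn : (g , ts) ∈ Fin.Ω → (f , us) ∈ Fin.Ω → Part L Y (g ∷ f ∷ U) W t →
                    ∀ {us′ r₁ r₂ r₃} → Pointwise (Eval (g , ts)) us us′ → Eval (f , us) t r₁ →
                    Eval (g , ts) r₁ r₂ → Eval (g , ts) t r₃ → Eval (f , us′) r₃ r₂
        distribIn ω υ p = Fin.Eval-distrib (Li-leftIdeal 𝓥 em locally)
          (Fin.accessible ω) (Fin.accessible υ) ω υ p

    evaluateᴸ : ∀ g (ts : Vec [ t ∈ Term τ X ∣ L t ] (nE g)) t →
                ∃[ r ] Eval (g , values ts) (value t) r × L r
    evaluateᴸ g ts t = evaluate g (values ts) (value t) (recompute-All em ts) (L-proof t)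

    -- One choice of values serves all parts, since `Eval⇒Apply` recovers a rank in whichever part
    -- contains the arguments.
    operations : FittedOperations L
    operations = record
      { _♯        = λ g ts t → let r , _ , p = evaluateᴸ g ts t in r , [ p ]
      ; restricts = λ Y U W g g∈U ts t ps p →
          OnFinite.Eval⇒Apply Y U W (g∈U , ps) p (proj₁ (proj₂ (evaluateᴸ g ts t)))
      }

    open FittedOperations operations using () renaming (_♯ to _♯ᴸ)

    ♯-Eval : ∀ g ts t → Eval (g , values ts) (value t) (value ((g ♯ᴸ) ts t))
    ♯-Eval g ts t = proj₁ (proj₂ (evaluateᴸ g ts t))

    ♯-Eval* : ∀ g ts (us : Vec [ t ∈ Term τ X ∣ L t ] n) →
              Pointwise (Eval (g , values ts)) (values us) (values (map ((g ♯ᴸ) ts) us))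
    ♯-Eval* g ts []       = []
    ♯-Eval* g ts (u ∷ us) = ♯-Eval g ts u ∷ ♯-Eval* g ts us

    table-L : Algebra τ
    table-L = table L locallyOperable operations

    φ-homomorphism : Nondegenerate τ → IsHomomorphism table-L 𝓥 φ
    φ-homomorphism nd = record
      { ♯-homo  = λ f ts t → begin
          φ ((f ♯ᴸ) ts t)                     ≡⟨ φ-⟦⟧ ((f ♯ᴸ) ts t) ⟩
          ⟦ value ((f ♯ᴸ) ts t) ⟧             ≡⟨ Eval-⟦⟧ em endo nd (♯-Eval f ts t) ⟩
          (f ♯) ⟦ values ts ⟧* ⟦ value t ⟧    ≡⟨ cong₂ (f ♯) (map-φ-⟦⟧ ts) (φ-⟦⟧ t) ⟨
          (f ♯) (map φ ts) (φ t)              ∎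
      ; op-homo = λ g ts →
          trans (φ-⟦⟧ (Algebra.op table-L g ts)) (cong (op g) (≡-sym (map-φ-⟦⟧ ts)))
      }
      where open ≡-Reasoning

    table-partiallyEndomorphic :
      IsPartiallyEndomorphicLaverTable L locallyOperable operations
    table-partiallyEndomorphic g ts = record
      { ♯-homo  = λ f us t → value-injective (Eval-functional
          (Eval-distrib-L
             (recompute-All em ts) (recompute-All em us) (L-proof t)
             (♯-Eval* g ts us) (♯-Eval f us t) (♯-Eval g ts ((f ♯ᴸ) us t)) (♯-Eval g ts t))
          (♯-Eval f (map ((g ♯ᴸ) ts) us) ((g ♯ᴸ) ts t)))
      ; op-homo = λ k us → value-injective (Eval-functional
          (♯-Eval g ts (Algebra.op table-L k us))
          (Eval-fun em endo (♯-Eval* g ts us)))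
      }

    -- Here nilpotence holds in the whole hull, so `L` can be ranked at once with no restriction on
    -- the factors.
    L-operable : IsLaverLike 𝓥 → IsOperable Full Full Full L
    L-operable laver = OnPart.operable em endo L-admissible id
      (λ {_} {x} _ _ → node∈L⁺ {x = x}) {S = Full} (λ _ _ → tt)
      (λ z _ → LaverLike.nilpotence laver z)

theorem5p10 : ∀ {ℓ : Level} → ExcludedMiddle (suc ℓ) →
    (τ : Type ℓ) (𝓥 : Algebra τ) →
    IsPartiallyEndomorphic 𝓥 → IsLocallyLaverLike 𝓥 →
    (X : Set ℓ) (v : X → Algebra.Carrier 𝓥) →
    let open Construction 𝓥 v in
    Σ[ lo ∈ LocallyOperable L ] Σ[ ops ∈ FittedOperations L ]
    ( (Nondegenerate τ → IsHomomorphism (table L lo ops) 𝓥 φ)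
    × IsPartiallyEndomorphicLaverTable L lo ops
    × (IsLaverLike 𝓥 → Operable L) )
theorem5p10 em τ 𝓥 endo locally X v =
  locallyOperable , operations , φ-homomorphism , table-partiallyEndomorphic , L-operable
  where
  open Evaluation 𝓥 v
  open Global (λ {P} → Dec.map′ lower lift (em {Lift _ P})) endo locally
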